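{- Let $\varphi\in\mathrm{For}(\Sigma)$. If $\nvdash_{\mathrm{RmbC}(i1)}\varphi$, then there exist a finite BALFI $\mathbf{A}\in\mathsf{BI}(i1)$ and a valuation $v:\mathrm{For}(\Sigma)\to A$ such that $v(\varphi)\neq 1$.
   Context: $\mathrm{For}(\Sigma)$ is the set of formulas built from a countably infinite set of propositional variables using binary $\wedge,\vee,\to$ and unary $\neg,\circ$; $\alpha\leftrightarrow\beta$ abbreviates $(\alpha\to\beta)\wedge(\beta\to\alpha)$. The logic $\mathrm{RmbC}$ is given by the Hilbert calculus with axiom schemas $\alpha\to(\beta\to\alpha)$; $(\alpha\to(\beta\to\gamma))\to((\alpha\to\beta)\to(\alpha\to\gamma))$; $\alpha\to(\beta\to(\alpha\wedge\beta))$; $(\alpha\wedge\beta)\to\alpha$; $(\alpha\wedge\beta)\to\beta$; $\alpha\to(\alpha\vee\beta)$; $\beta\to(\alpha\vee\beta)$; $(\alpha\to\gamma)\to((\beta\to\gamma)\to((\alpha\vee\beta)\to\gamma))$; $(\alpha\to\beta)\vee\alpha$; $\alpha\vee\neg\alpha$; $\circ\alpha\to(\alpha\to(\neg\alpha\to\beta))$; and inference rules: modus ponens; $(R_\neg)$: from $\alpha\leftrightarrow\psi$ infer $\neg\alpha\leftrightarrow\neg\psi$; $(R_\circ)$: from $\alpha\leftrightarrow\psi$ infer $\circ\alpha\leftrightarrow\circ\psi$. $\mathrm{RmbC}(i1)$ is obtained by adding the axiom schema $(i1)$: $\neg{\circ}\alpha\to\alpha$, and $\vdash_{\mathrm{RmbC}(i1)}\varphi$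 means $\varphi$ is derivable in it (without premises). A BALFI is an algebra $\mathbf{B}=\langle B,\wedge,\vee,\to,\neg,\circ,0,1\rangle$ such that $\langle B,\wedge,\vee,\to,0,1\rangle$ is a Boolean algebra and, for every $a\in B$, $a\vee\neg a=1$ and $a\wedge\neg a\wedge\circ a=0$. A valuation over $\mathbf{B}$ is a homomorphism $v:\mathrm{For}(\Sigma)\to B$. $\mathsf{BI}(i1)$ is the class of BALFIs validating $(i1)$, equivalently satisfying $\neg(\circ a)\wedge a=\neg(\circ a)$ for all $a$. -}

module Defs where

open import Algebra.Core using (Op₁; Op₂)
open import Algebra.Definitions using (Congruent₁)
open import Algebra.Lattice.Structures using (IsBooleanAlgebra)
open import Data.Fin.Base using (Fin)
open import Data.Nat.Base using (ℕ)
open import Data.Product.Base using (∃)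
open import Function.Bundles using (Inverse)
open import Level using (Level; 0ℓ; _⊔_; suc)
open import Relation.Binary.Bundles using (Setoid)
open import Relation.Binary.Core using (Rel)
open import Relation.Binary.PropositionalEquality using (setoid)
open import Relation.Unary using (Pred; _∪_)

private
  variable
    c ℓ : Level

infix  8 ¬ᶠ_ ○ᶠ_
infixr 7 _∧ᶠ_
infixr 6 _∨ᶠ_
infixr 5 _⇒ᶠ_
infix  4 _⇔ᶠ_

data Formula : Set where
  var            : ℕ → Formula
  _∧ᶠ_ _∨ᶠ_ _⇒ᶠ_ : Formula → Formula → Formula
  ¬ᶠ_ ○ᶠ_        : Formula → Formula

_⇔ᶠ_ : Formula → Formula → Formula
α ⇔ᶠ β = (α ⇒ᶠ β) ∧ᶠ (β ⇒ᶠ α)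

data mbC-Axiom : Pred Formula 0ℓ where
  ⇒-K       : ∀ α β → mbC-Axiom (α ⇒ᶠ (β ⇒ᶠ α))
  ⇒-S       : ∀ α β γ → mbC-Axiom ((α ⇒ᶠ (β ⇒ᶠ γ)) ⇒ᶠ ((α ⇒ᶠ β) ⇒ᶠ (α ⇒ᶠ γ)))
  ∧-intro   : ∀ α β → mbC-Axiom (α ⇒ᶠ (β ⇒ᶠ (α ∧ᶠ β)))
  ∧-elimˡ   : ∀ α β → mbC-Axiom ((α ∧ᶠ β) ⇒ᶠ α)
  ∧-elimʳ   : ∀ α β → mbC-Axiom ((α ∧ᶠ β) ⇒ᶠ β)
  ∨-introˡ  : ∀ α β → mbC-Axiom (α ⇒ᶠ (α ∨ᶠ β))
  ∨-introʳ  : ∀ α β → mbC-Axiom (β ⇒ᶠ (α ∨ᶠ β))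
  ∨-elim    : ∀ α β γ → mbC-Axiom ((α ⇒ᶠ γ) ⇒ᶠ ((β ⇒ᶠ γ) ⇒ᶠ ((α ∨ᶠ β) ⇒ᶠ γ)))
  ⇒-or      : ∀ α β → mbC-Axiom ((α ⇒ᶠ β) ∨ᶠ α)
  ¬-exmid   : ∀ α → mbC-Axiom (α ∨ᶠ (¬ᶠ α))
  ○-explode : ∀ α β → mbC-Axiom ((○ᶠ α) ⇒ᶠ (α ⇒ᶠ ((¬ᶠ α) ⇒ᶠ β)))

data i1-Axiom : Pred Formula 0ℓ where
  i1 : ∀ α → i1-Axiom ((¬ᶠ (○ᶠ α)) ⇒ᶠ α)

-- Derivations have no premises, so R¬ and R○ apply to theorems only.
data Theorem (Ax : Pred Formula 0ℓ) : Pred Formula 0ℓ where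
  axiom : ∀ {α} → Ax α → Theorem Ax α
  mp    : ∀ {α β} → Theorem Ax (α ⇒ᶠ β) → Theorem Ax α → Theorem Ax β
  R¬    : ∀ {α ψ} → Theorem Ax (α ⇔ᶠ ψ) → Theorem Ax ((¬ᶠ α) ⇔ᶠ (¬ᶠ ψ))
  R○    : ∀ {α ψ} → Theorem Ax (α ⇔ᶠ ψ) → Theorem Ax ((○ᶠ α) ⇔ᶠ (○ᶠ ψ))

infix 3 ⊢RmbC[i1]_

⊢RmbC[i1]_ : Pred Formula 0ℓ
⊢RmbC[i1]_ = Theorem (mbC-Axiom ∪ i1-Axiom)

-- The signature has no symbol for the Boolean complement: it is the term
-- a ⇒ ⊥, while ¬ is the paraconsistent negation.
record BALFI c ℓ : Set (suc (c ⊔ ℓ)) where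
  infix  8 ¬_ ○_
  infixr 7 _∧_
  infixr 6 _∨_
  infixr 5 _⇒_
  infix  4 _≈_
  field
    Carrier          : Set c
    _≈_              : Rel Carrier ℓ
    _∧_ _∨_ _⇒_      : Op₂ Carrier
    ¬_ ○_            : Op₁ Carrier
    ⊥ ⊤              : Carrier
    isBooleanAlgebra : IsBooleanAlgebra _≈_ _∨_ _∧_ (λ a → a ⇒ ⊥) ⊤ ⊥
    ⇒-def            : ∀ a b → (a ⇒ b) ≈ ((a ⇒ ⊥) ∨ b)
    ¬-cong           : Congruent₁ _≈_ ¬_
    ○-cong           : Congruent₁ _≈_ ○_
    ∨-¬              : ∀ a → (a ∨ (¬ a)) ≈ ⊤
    ∧-¬-○            : ∀ a → ((a ∧ (¬ a)) ∧ (○ a)) ≈ ⊥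

  open IsBooleanAlgebra isBooleanAlgebra public
    using (isEquivalence)

  carrierSetoid : Setoid c ℓ
  carrierSetoid = record { isEquivalence = isEquivalence }

-- Elements are counted up to _≈_.
Finite : Pred (BALFI c ℓ) (c ⊔ ℓ)
Finite B = ∃ λ n → Inverse (setoid (Fin n)) (BALFI.carrierSetoid B)

record Valuation (B : BALFI c ℓ) : Set (c ⊔ ℓ) where
  open BALFI B
  field
    ⟦_⟧    : Formula → Carrier
    ∧-homo : ∀ α β → ⟦ α ∧ᶠ β ⟧ ≈ (⟦ α ⟧ ∧ ⟦ β ⟧)
    ∨-homo : ∀ α β → ⟦ α ∨ᶠ β ⟧ ≈ (⟦ α ⟧ ∨ ⟦ β ⟧)
    ⇒-homo : ∀ α β → ⟦ α ⇒ᶠ β ⟧ ≈ (⟦ α ⟧ ⇒ ⟦ β ⟧)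
    ¬-homo : ∀ α → ⟦ ¬ᶠ α ⟧ ≈ (¬ ⟦ α ⟧)
    ○-homo : ∀ α → ⟦ ○ᶠ α ⟧ ≈ (○ ⟦ α ⟧)

infix 4 _satisfies_

_satisfies_ : {B : BALFI c ℓ} → Valuation B → Formula → Set ℓ
_satisfies_ {B = B} v φ = ⟦ φ ⟧ ≈ ⊤
  where
  open BALFI B
  open Valuation v

infix 4 _validates_

_validates_ : BALFI c ℓ → Formula → Set (c ⊔ ℓ)
B validates φ = (v : Valuation B) → v satisfies φ

BI[i1] : Pred (BALFI c ℓ) (c ⊔ ℓ)
BI[i1] B = ∀ α → i1-Axiom α → B validates α

{-# OPTIONS --safe #-}
-- A valuation satisfying only the propositional laws is determined by its
-- values on variables, negations and ○-formulas.  Propositional completeness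
-- concerns finitely many such worlds at a time, and the rules of RmbC(i1) enter
-- by discarding worlds: whenever ψ holds in all remaining worlds and ⊢ ψ
-- implies ⊢ θ, the worlds refuting θ are dropped.  For finitely many rules this
-- stops at a finite set W in which validity still implies provability.
--
-- Take the instances of the rules for subformulas of φ.  In the power set of W
-- the truth sets ⟪ α ⟫ dictate ¬ ⟪ α ⟫ = ⟪ ¬ α ⟫ and ○ ⟪ α ⟫ = ⟪ ○ α ⟫.  On the
-- remaining sets a one wants ¬ a = ∁ a and ○ a ⊇ ∁ a, but (i1) asks in addition
-- for ¬ ○ a ⊆ a, which is only automatic if ○ a is not a truth set either.
-- Therefore every world is doubled: a set separating a world from its twin is
-- never a truth set, so ○ a = ∁ ⁅ x ⁆ with x ∈ a does the job.
module Submission where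

open import Defs
open import Algebra.Lattice.Structures using (IsBooleanAlgebra)
open import Data.Bool.Base using (Bool; true; false; not; T; if_then_else_)
  renaming (_∧_ to _∧ᵇ_; _∨_ to _∨ᵇ_)
open import Data.Bool.Properties using (T?; T-≡; T-∧; T-∨)
import Data.Bool.Properties as Bool
open import Data.Empty using (⊥-elim)
open import Data.Fin.Base using (Fin; zero; suc; remQuot; combine; opposite)
open import Data.Fin.Properties using (remQuot-combine; *↔×; 2↔Bool)
open import Data.Fin.Subset using (Subset; ∁; ⁅_⁆; ⊤; ⊥; _∩_; _∪_; _⊆_)
  renaming (_∈_ to _∈ˢ_; _∉_ to _∉ˢ_)
open import Data.Fin.Subset.Properties
  using ( ⊆-antisym; ⊆⊤; ⊥⊆; ∈⊤; nonempty?; _∈?_; x∈⁅x⁆; x∈⁅y⁆⇒x≡y; x∈p⇒x∉∁p; x∈∁p⇒x∉p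
        ; x∉∁p⇒x∈p; x∉p⇒x∈∁p; x∈p∪q⁺; x∈p∩q⁻; ∪-identityʳ; ∪-∩-isBooleanAlgebra)
open import Data.List.Base
  using (List; []; _∷_; [_]; _++_; map; concat; filter; length; lookup; cartesianProductWith)
open import Data.List.Membership.Propositional using (find; lose) renaming (_∈_ to _∈ˡ_)
open import Data.List.Membership.Propositional.Properties
  using (∈-++⁺ˡ; ∈-++⁺ʳ; ∈-++⁻; ∈-map⁺; ∈-concat⁺′; ∈-cartesianProductWith⁺; ∈-filter⁺; ∈-filter⁻; ∈-lookup)
open import Data.List.Properties using () renaming (≡-dec to List-≡-dec; ∷-injectiveˡ to head-injective)
open import Data.List.Relation.Binary.Subset.Propositional using () renaming (_⊆_ to _⊆ˡ_)
open import Data.List.Relation.Unary.All as All using (All; []; _∷_; all?)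
open import Data.List.Relation.Unary.All.Properties using (++⁻ˡ; ++⁻ʳ)
open import Data.List.Relation.Unary.Any using (here; there; any?; index)
open import Data.List.Relation.Unary.Any.Properties using (lookup-index)
open import Data.Nat.Base using (ℕ; zero; suc; _*_; _^_)
open import Data.Nat.Properties using () renaming (_≟_ to _≟ℕ_)
open import Data.Product.Base using (_×_; Σ-syntax; _,_; proj₁; proj₂; uncurry)
open import Data.Product.Function.NonDependent.Propositional using (_×-↔_)
open import Data.Sum.Base as Sum using (_⊎_; inj₁; inj₂; [_,_]′)
open import Data.Unit.Base using (tt)
open import Data.Vec.Base using ([]; _∷_; tabulate; zipWith)
open import Data.Vec.Properties using ([]=⇒lookup; lookup⇒[]=; lookup∘tabulate; tabulate-∘)
  renaming (≡-dec to Vec-≡-dec)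
open import Function.Base using (id; _∘_; const)
open import Function.Bundles using (Equivalence; _⇔_; mk⇔; _↔_; mk↔ₛ′)
open import Function.Properties.Inverse using (↔-trans)
open import Level using (0ℓ)
open import Relation.Binary.Definitions using (DecidableEquality)
open import Relation.Binary.PropositionalEquality
  using (_≡_; _≢_; refl; sym; trans; cong; cong₂; subst; module ≡-Reasoning)
open import Relation.Nullary.Decidable using (Dec; yes; no; does; map′; _×-dec_; ¬?)
open import Relation.Nullary.Negation.Core using (¬_; contradiction)
open import Relation.Unary using (_∈_)

open Equivalence using (to; from)

infix 3 ⊢_ _⊩_ _⊨_ _⊫_

⊢_ : Formula → Set
⊢ α = ⊢RmbC[i1] α

-- The signature has no falsum. For `eval` the conjuncts are independent atoms, so a world may
-- satisfy this formula, and such worlds must be excluded explicitly.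
⊥ᶠ : Formula
⊥ᶠ = var 0 ∧ᶠ (¬ᶠ var 0 ∧ᶠ ○ᶠ var 0)

⊤ᶠ : Formula
⊤ᶠ = ⊥ᶠ ⇒ᶠ ⊥ᶠ

private
  variable
    α β γ ψ θ : Formula

-- Derivations under one hypothesis

-- The hypothesis is the antecedent of a theorem, not a premise, because `R¬` and `R○` apply to
-- theorems only.
_⊩_ : Formula → Formula → Set
γ ⊩ α = ⊢ (γ ⇒ᶠ α)

ax : ∀ {α} → mbC-Axiom α → ⊢ α
ax a = axiom (inj₁ a)

const-⊩ : ⊢ α → γ ⊩ α
const-⊩ = mp (ax (⇒-K _ _))

app : γ ⊩ α ⇒ᶠ β → γ ⊩ α → γ ⊩ β
app p q = mp (mp (ax (⇒-S _ _ _)) p) q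

id-⊩ : α ⊩ α
id-⊩ {α} = app {β = α} (ax (⇒-K α (α ⇒ᶠ α))) (ax (⇒-K α α))

infixl 4 _⨾_

_⨾_ : α ⊩ β → β ⊩ γ → α ⊩ γ
p ⨾ q = app (const-⊩ q) p

pair : γ ⊩ α → γ ⊩ β → γ ⊩ α ∧ᶠ β
pair p q = app (p ⨾ ax (∧-intro _ _)) q

fst : α ∧ᶠ β ⊩ α
fst = ax (∧-elimˡ _ _)

snd : α ∧ᶠ β ⊩ β
snd = ax (∧-elimʳ _ _)

curry-⊩ : γ ∧ᶠ α ⊩ β → γ ⊩ α ⇒ᶠ β
curry-⊩ p = app (ax (∧-intro _ _) ⨾ ax (⇒-K _ _) ⨾ swap) (const-⊩ p)
  where
  swap : ∀ {α β γ} → ((β ⇒ᶠ γ) ⇒ᶠ (α ⇒ᶠ β)) ⊩ ((β ⇒ᶠ γ) ⇒ᶠ (α ⇒ᶠ γ))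
  swap = mp (ax (⇒-S _ _ _)) (ax (⇒-K _ _) ⨾ ax (⇒-S _ _ _))

cases : γ ⊩ α ∨ᶠ β → γ ∧ᶠ α ⊩ ψ → γ ∧ᶠ β ⊩ ψ → γ ⊩ ψ
cases d p q = app (app (curry-⊩ p ⨾ ax (∨-elim _ _ _)) (curry-⊩ q)) d

explode : ⊥ᶠ ⊩ α
explode = app (app (snd ⨾ snd ⨾ ax (○-explode _ _)) fst) (snd ⨾ fst)

lem : γ ⊩ α ∨ᶠ (α ⇒ᶠ β)
lem = const-⊩ (mp (mp (mp (ax (∨-elim _ _ _)) (ax (∨-introʳ _ _))) (ax (∨-introˡ _ _))) (ax (⇒-or _ _)))

-- Propositional completeness

World : Set
World = Formula → Bool

eval : World → Formula → Bool
eval w (α ∧ᶠ β) = eval w α ∧ᵇ eval w β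
eval w (α ∨ᶠ β) = eval w α ∨ᵇ eval w β
eval w (α ⇒ᶠ β) = not (eval w α) ∨ᵇ eval w β
eval w α        = w α

_⊨_ : World → Formula → Set
w ⊨ α = T (eval w α)

⊨-⇒ : ∀ {w} α β → (w ⊨ α ⇒ᶠ β) ⇔ (w ⊨ α → w ⊨ β)
⊨-⇒ {w} α β with eval w α
... | true  = mk⇔ const (λ f → f tt)
... | false = mk⇔ (λ _ ()) (const tt)

atoms : Formula → List Formula
atoms (α ∧ᶠ β) = atoms α ++ atoms β
atoms (α ∨ᶠ β) = atoms α ++ atoms β
atoms (α ⇒ᶠ β) = atoms α ++ atoms β
atoms α        = [ α ]

signed : Bool → Formula → Formula
signed true  α = α
signed false α = α ⇒ᶠ ⊥ᶠ

Decides : Formula → World → Formula → Set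
Decides γ w α = γ ⊩ signed (w α) α

-- Kalmár's lemma: each row of a truth table becomes a derivation from the signed atoms.
kalmár : ∀ {γ w} α → All (Decides γ w) (atoms α) → Decides γ (eval w) α
kalmár         (var i)  (p ∷ []) = p
kalmár         (¬ᶠ α)   (p ∷ []) = p
kalmár         (○ᶠ α)   (p ∷ []) = p
kalmár {w = w} (α ∧ᶠ β) ps
  with eval w α | kalmár α (++⁻ˡ (atoms α) ps) | eval w β | kalmár β (++⁻ʳ (atoms α) ps)
... | true  | p | true  | q = pair p q
... | true  | p | false | q = curry-⊩ (app (fst ⨾ q) (snd ⨾ snd))
... | false | p | _     | q = curry-⊩ (app (fst ⨾ p) (snd ⨾ fst))
kalmár {w = w} (α ∨ᶠ β) ps
  with eval w α | kalmár α (++⁻ˡ (atoms α) ps) | eval w β | kalmár β (++⁻ʳ (atoms α) ps)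
... | true  | p | _     | q = p ⨾ ax (∨-introˡ _ _)
... | false | p | true  | q = q ⨾ ax (∨-introʳ _ _)
... | false | p | false | q = app (p ⨾ ax (∨-elim _ _ _)) q
kalmár {w = w} (α ⇒ᶠ β) ps
  with eval w α | kalmár α (++⁻ˡ (atoms α) ps) | eval w β | kalmár β (++⁻ʳ (atoms α) ps)
... | true  | p | true  | q = q ⨾ ax (⇒-K _ _)
... | true  | p | false | q = curry-⊩ (app (fst ⨾ q) (app snd (fst ⨾ p)))
... | false | p | _     | q = curry-⊩ (app (fst ⨾ p) snd ⨾ explode)

-- Postfix notation; the stack machine run witnesses that it is injective.
postfix : Formula → List ℕ → List ℕ
postfix (α ∧ᶠ β) ts = postfix α (postfix β (0 ∷ ts))
postfix (α ∨ᶠ β) ts = postfix α (postfix β (1 ∷ ts))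
postfix (α ⇒ᶠ β) ts = postfix α (postfix β (2 ∷ ts))
postfix (¬ᶠ α)   ts = postfix α (3 ∷ ts)
postfix (○ᶠ α)   ts = postfix α (4 ∷ ts)
postfix (var i)  ts = suc (suc (suc (suc (suc i)))) ∷ ts

run : List ℕ → List Formula → List Formula
run (0 ∷ ts) (β ∷ α ∷ σ) = run ts ((α ∧ᶠ β) ∷ σ)
run (1 ∷ ts) (β ∷ α ∷ σ) = run ts ((α ∨ᶠ β) ∷ σ)
run (2 ∷ ts) (β ∷ α ∷ σ) = run ts ((α ⇒ᶠ β) ∷ σ)
run (3 ∷ ts) (α ∷ σ)     = run ts ((¬ᶠ α) ∷ σ)
run (4 ∷ ts) (α ∷ σ)     = run ts ((○ᶠ α) ∷ σ)
run (suc (suc (suc (suc (suc i)))) ∷ ts) σ = run ts (var i ∷ σ)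
-- This is also the regular end: once the tokens are used up, the stack is the result.
run _        σ           = σ

run-postfix : ∀ α ts σ → run (postfix α ts) σ ≡ run ts (α ∷ σ)
run-postfix (α ∧ᶠ β) ts σ = trans (run-postfix α _ σ) (run-postfix β _ (α ∷ σ))
run-postfix (α ∨ᶠ β) ts σ = trans (run-postfix α _ σ) (run-postfix β _ (α ∷ σ))
run-postfix (α ⇒ᶠ β) ts σ = trans (run-postfix α _ σ) (run-postfix β _ (α ∷ σ))
run-postfix (¬ᶠ α)   ts σ = run-postfix α _ σ
run-postfix (○ᶠ α)   ts σ = run-postfix α _ σ
run-postfix (var i)  ts σ = refl

postfix-injective : postfix α [] ≡ postfix β [] → α ≡ β
postfix-injective {α} {β} eq =
  head-injective (trans (sym (run-postfix α [] [])) (trans (cong (λ ts → run ts []) eq) (run-postfix β [] [])))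

-- Opaque, so that with-abstraction finds it in the body of _[_≔_].
abstract
  _≟_ : DecidableEquality Formula
  α ≟ β = map′ postfix-injective (cong (λ γ → postfix γ [])) (List-≡-dec _≟ℕ_ (postfix α []) (postfix β []))

_[_≔_] : World → Formula → Bool → World
(w [ q ≔ b ]) p = if does (p ≟ q) then b else w p

assignments : List Formula → World → List World
assignments []      w = [ w ]
assignments (q ∷ Q) w = assignments Q (w [ q ≔ true ]) ++ assignments Q (w [ q ≔ false ])

-- An atom may occur in `Q` although it is decided already: the new sign overrides the old one, and
-- the new conjunct `signed b q` settles it.
decides-update : ∀ {γ q} w b {Q p} → p ∈ˡ q ∷ Q ⊎ Decides γ w p →
                 p ∈ˡ Q ⊎ Decides (γ ∧ᶠ signed b q) (w [ q ≔ b ]) p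
decides-update {q = q} w b {p = p} h with p ≟ q | h
... | yes refl | _                 = inj₂ snd
... | no  p≢q  | inj₁ (here p≡q)   = contradiction p≡q p≢q
... | no  _    | inj₁ (there p∈Q)  = inj₁ p∈Q
... | no  _    | inj₂ d            = inj₂ (fst ⨾ d)

-- Shannon expansion: branch on the atoms in `Q` by excluded middle. At a leaf every atom of `ψ` is
-- decided, so `kalmár` applies.
shannon : ∀ Q {γ w ψ} → All (λ p → p ∈ˡ Q ⊎ Decides γ w p) (atoms ψ) →
          All (_⊨ ψ) (assignments Q w) → γ ⊩ ψ
shannon [] {γ} {w} {ψ} ds (p ∷ []) =
  subst (λ b → γ ⊩ signed b ψ) (to T-≡ p) (kalmár {w = w} ψ (All.map (λ { (inj₂ d) → d }) ds))
shannon (q ∷ Q) {w = w} ds ps =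
  cases lem
    (shannon Q {w = w [ q ≔ true ]} (All.map (decides-update w true) ds)
      (++⁻ˡ (assignments Q (w [ q ≔ true ])) ps))
    (shannon Q {w = w [ q ≔ false ]} (All.map (decides-update w false) ds)
      (++⁻ʳ (assignments Q (w [ q ≔ true ])) ps))

completeness : ∀ Q {w ψ} → atoms ψ ⊆ˡ Q → All (_⊨ ψ) (assignments Q w) → ⊢ ψ
completeness Q {w} {ψ} over ps = mp (shannon Q {γ = ⊤ᶠ} {w} (All.tabulate (inj₁ ∘ over)) ps) id-⊩

-- Saturation under admissible rules

-- No provable implication from premise to conclusion is asked for, as `R¬` and `R○` offer none.
record Rule : Set where
  constructor rule
  field
    {premise conclusion} : Formula
    admissible           : ⊢ premise → ⊢ conclusion

open Rule

-- The premise holds in every world, so saturation imposes the theorem on all remaining ones.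
theorem-rule : ⊢ α → Rule
theorem-rule p = rule {premise = ⊤ᶠ} (const p)

_⊫_ : List World → Formula → Set
W ⊫ ψ = All (_⊨ ψ) W

module Saturation (Q : List Formula) (⊥-over : atoms ⊥ᶠ ⊆ˡ Q) where

  -- The conclusions fired so far, conjoined into one theorem.
  record Theory : Set where
    constructor theory
    field
      {formula} : Formula
      provable  : ⊢ formula
      over      : atoms formula ⊆ˡ Q

  open Theory

  _≤_ : Theory → Theory → Set
  τ ≤ τ′ = ∀ {w} → w ⊨ formula τ → w ⊨ formula τ′

  worlds : List World
  worlds = assignments Q (const false)

  Model : Theory → World → Set
  Model τ w = w ⊨ formula τ × ¬ (w ⊨ ⊥ᶠ)

  model? : ∀ τ w → Dec (Model τ w)
  model? τ w = T? (eval w (formula τ)) ×-dec ¬? (T? (eval w ⊥ᶠ))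

  models : Theory → List World
  models τ = filter (model? τ) worlds

  -- A discarded world refutes `formula τ` or satisfies `⊥ᶠ`, so `formula τ ⇒ᶠ (⊥ᶠ ∨ᶠ ψ)` is true in
  -- all of `worlds` and hence provable. Then `provable τ` and `explode` leave `ψ`.
  ⊫-models⇒⊢ : ∀ τ → atoms ψ ⊆ˡ Q → models τ ⊫ ψ → ⊢ ψ
  ⊫-models⇒⊢ {ψ} τ o p =
    mp (cases (const-⊩ τ⊢⊥∨ψ) (snd ⨾ explode) snd) (provable τ)
    where
    holds : ∀ {w} → w ∈ˡ worlds → w ⊨ formula τ → w ⊨ ⊥ᶠ ∨ᶠ ψ
    holds {w} w∈ m with T? (eval w ⊥ᶠ)
    ... | yes b = from (T-∨ {eval w ⊥ᶠ}) (inj₁ b)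
    ... | no ¬b = from (T-∨ {eval w ⊥ᶠ}) (inj₂ (All.lookup p (∈-filter⁺ (model? τ) w∈ (m , ¬b))))

    over-⇒ : atoms (formula τ ⇒ᶠ (⊥ᶠ ∨ᶠ ψ)) ⊆ˡ Q
    over-⇒ = [ over τ , [ ⊥-over , o ]′ ∘ ∈-++⁻ (atoms ⊥ᶠ) ]′ ∘ ∈-++⁻ (atoms (formula τ))

    τ⊢⊥∨ψ : ⊢ (⊥ᶠ ∨ᶠ ψ)
    τ⊢⊥∨ψ = mp (completeness Q over-⇒
      (All.tabulate λ w∈ → from (⊨-⇒ (formula τ) (⊥ᶠ ∨ᶠ ψ)) (holds w∈))) (provable τ)

  Closed : Theory → Rule → Set
  Closed τ r = models τ ⊫ premise r → models τ ⊫ conclusion r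

  Over : Rule → Set
  Over r = atoms (premise r) ⊆ˡ Q × atoms (conclusion r) ⊆ˡ Q

  -- Admissibility enters here: a premise true in all models is a theorem, hence so is the
  -- conclusion.
  extend : ∀ τ r → Over r → models τ ⊫ premise r → Theory
  extend τ r (op , oc) p =
    theory {formula τ ∧ᶠ conclusion r}
      (mp (mp (ax (∧-intro _ _)) (provable τ)) (admissible r (⊫-models⇒⊢ τ op p)))
      ([ over τ , oc ]′ ∘ ∈-++⁻ (atoms (formula τ)))

  -- A fired rule stays closed in every stronger theory, so after firing r the
  -- remaining rules are saturated once more and r need not be reconsidered.
  saturate : ∀ R → All Over R → ∀ τ → Σ[ τ′ ∈ Theory ] (τ′ ≤ τ × All (Closed τ′) R)
  saturate []      []       τ = τ , id , []
  saturate (r ∷ R) (o ∷ os) τ with saturate R os τ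
  ... | τ₁ , τ₁≤τ , closed₁ with all? (λ w → T? (eval w (premise r))) (models τ₁)
  ...   | no ¬p = τ₁ , τ₁≤τ , (λ p → contradiction p ¬p) ∷ closed₁
  ...   | yes p with saturate R os (extend τ₁ r o p)
  ...     | τ₂ , τ₂≤ , closed₂ =
    τ₂ , (λ m → τ₁≤τ (proj₁ (to T-∧ (τ₂≤ m)))) , const (All.tabulate fired) ∷ closed₂
    where
    fired : ∀ {w} → w ∈ˡ models τ₂ → w ⊨ conclusion r
    fired {w} w∈ = proj₂ (to (T-∧ {eval w (formula τ₁)})
      (τ₂≤ (proj₁ (proj₂ (∈-filter⁻ (model? τ₂) {xs = worlds} w∈)))))

saturation : ∀ R φ → Σ[ W ∈ List World ]
  (All (λ w → ¬ (w ⊨ ⊥ᶠ)) W × All (λ r → W ⊫ premise r → W ⊫ conclusion r) R × (W ⊫ φ → ⊢ φ))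
saturation R φ =
  models τ , All.tabulate (λ w∈ → proj₂ (proj₂ (∈-filter⁻ (model? τ) {xs = worlds} w∈))) ,
  proj₂ (proj₂ saturated) , ⊫-models⇒⊢ τ (over-Q (there (here refl)))
  where
  formulas = ⊥ᶠ ∷ φ ∷ map premise R ++ map conclusion R

  Q = concat (map atoms formulas)

  over-Q : ∀ {ψ} → ψ ∈ˡ formulas → atoms ψ ⊆ˡ Q
  over-Q ψ∈ p∈ = ∈-concat⁺′ p∈ (∈-map⁺ atoms ψ∈)

  open Saturation Q (over-Q (here refl))

  saturated = saturate R
    (All.tabulate λ r∈ → over-Q (there (there (∈-++⁺ˡ (∈-map⁺ premise r∈))))
                       , over-Q (there (there (∈-++⁺ʳ (map premise R) (∈-map⁺ conclusion r∈)))))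
    (theory {⊤ᶠ} id-⊩ ([ over-Q (here refl) , over-Q (here refl) ]′ ∘ ∈-++⁻ (atoms ⊥ᶠ)))

  τ = proj₁ saturated

-- The rules of RmbC(i1) for a finite set of formulas

-- `○ᶠ α` itself may lie outside the finite set, which may still contain another formula `β` with
-- the same truth set; (i1) is needed for that `β`.
¬○-elim : ⊢ (β ⇔ᶠ ○ᶠ α) → ⊢ (¬ᶠ β ⇒ᶠ α)
¬○-elim p = mp fst (R¬ p) ⨾ axiom (inj₂ (i1 _))

-- Serves the case where no formula of the finite set has the truth set of `○ᶠ α`: there `¬` is the
-- complement, which must lie inside `⟪ α ⟫`.
∨-○ : ⊢ (α ∨ᶠ ○ᶠ α)
∨-○ {α} = mp (mp (mp (ax (∨-elim _ _ _)) (ax (∨-introʳ α (○ᶠ α))))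
  (axiom (inj₂ (i1 α)) ⨾ ax (∨-introˡ α (○ᶠ α)))) (ax (¬-exmid (○ᶠ α)))

gentle : ⊢ ((α ∧ᶠ ¬ᶠ α) ∧ᶠ ○ᶠ α ⇒ᶠ ⊥ᶠ)
gentle = app (app (snd ⨾ ax (○-explode _ _)) (fst ⨾ fst)) (fst ⨾ snd)

rules : Formula → Formula → List Rule
rules α β =
    theorem-rule {α ∨ᶠ ¬ᶠ α} (ax (¬-exmid α))
  ∷ theorem-rule {(α ∧ᶠ ¬ᶠ α) ∧ᶠ ○ᶠ α ⇒ᶠ ⊥ᶠ} gentle
  ∷ theorem-rule {α ∨ᶠ ○ᶠ α} ∨-○
  ∷ rule {α ⇔ᶠ β} {¬ᶠ α ⇔ᶠ ¬ᶠ β} R¬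
  ∷ rule {α ⇔ᶠ β} {○ᶠ α ⇔ᶠ ○ᶠ β} R○
  ∷ rule {β ⇔ᶠ ○ᶠ α} {¬ᶠ β ⇒ᶠ α} ¬○-elim
  ∷ []

subformulas : Formula → List Formula
subformulas (α ∧ᶠ β) = (α ∧ᶠ β) ∷ subformulas α ++ subformulas β
subformulas (α ∨ᶠ β) = (α ∨ᶠ β) ∷ subformulas α ++ subformulas β
subformulas (α ⇒ᶠ β) = (α ⇒ᶠ β) ∷ subformulas α ++ subformulas β
subformulas (¬ᶠ α)   = (¬ᶠ α) ∷ subformulas α
subformulas (○ᶠ α)   = (○ᶠ α) ∷ subformulas α
subformulas (var i)  = [ var i ]

∈-subformulas : ∀ α → α ∈ˡ subformulas α
∈-subformulas (_ ∧ᶠ _) = here refl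
∈-subformulas (_ ∨ᶠ _) = here refl
∈-subformulas (_ ⇒ᶠ _) = here refl
∈-subformulas (¬ᶠ _)   = here refl
∈-subformulas (○ᶠ _)   = here refl
∈-subformulas (var _)  = here refl

-- The algebra of sets of doubled worlds

zipWith-tabulate : ∀ {m} (_∙_ : Bool → Bool → Bool) (f g : Fin m → Bool) →
                   zipWith _∙_ (tabulate f) (tabulate g) ≡ tabulate (λ i → f i ∙ g i)
zipWith-tabulate {zero}  _∙_ f g = refl
zipWith-tabulate {suc m} _∙_ f g = cong (f zero ∙ g zero ∷_) (zipWith-tabulate _∙_ (f ∘ suc) (g ∘ suc))

module Truth-sets
  {n} (world : Fin n → World) (⊥-false : ∀ x → ¬ (world x ⊨ ⊥ᶠ))
  (twin : Fin n → Fin n) (twin-≢ : ∀ x → twin x ≢ x) (twin-world : ∀ x → world (twin x) ≡ world x)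
  (S : List Formula) (⊥∈S : ⊥ᶠ ∈ˡ S)
  (closed : ∀ {α β} → α ∈ˡ S → β ∈ˡ S →
    All (λ r → (∀ x → world x ⊨ premise r) → ∀ x → world x ⊨ conclusion r) (rules α β))
  where

  private
    variable
      x : Fin n
      a : Subset n

  Holds : Formula → Set
  Holds ψ = ∀ x → world x ⊨ ψ

  ⟪_⟫ : Formula → Subset n
  ⟪ α ⟫ = tabulate λ x → eval (world x) α

  ∈-⟪⟫⁺ : ∀ α → world x ⊨ α → x ∈ˢ ⟪ α ⟫
  ∈-⟪⟫⁺ {x} α p = lookup⇒[]= x _ (trans (lookup∘tabulate _ x) (to T-≡ p))

  ∈-⟪⟫⁻ : ∀ α → x ∈ˢ ⟪ α ⟫ → world x ⊨ α
  ∈-⟪⟫⁻ {x} α p = from T-≡ (trans (sym (lookup∘tabulate _ x)) ([]=⇒lookup p))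

  ⟪⟫-⇒ : Holds (α ⇒ᶠ β) → ⟪ α ⟫ ⊆ ⟪ β ⟫
  ⟪⟫-⇒ {α} {β} h p = ∈-⟪⟫⁺ β (to (⊨-⇒ α β) (h _) (∈-⟪⟫⁻ α p))

  ⊆⇒Holds : ⟪ α ⟫ ⊆ ⟪ β ⟫ → Holds (α ⇒ᶠ β)
  ⊆⇒Holds {α} {β} α⊆β x = from (⊨-⇒ α β) (∈-⟪⟫⁻ β ∘ α⊆β ∘ ∈-⟪⟫⁺ α)

  ≡⇒Holds : ⟪ α ⟫ ≡ ⟪ β ⟫ → Holds (α ⇔ᶠ β)
  ≡⇒Holds {α} {β} eq x = from (T-∧ {eval (world x) (α ⇒ᶠ β)})
    (⊆⇒Holds {α} {β} (subst (_ ∈ˢ_) eq) x , ⊆⇒Holds {β} {α} (subst (_ ∈ˢ_) (sym eq)) x)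

  Holds⇒≡ : Holds (α ⇔ᶠ β) → ⟪ α ⟫ ≡ ⟪ β ⟫
  Holds⇒≡ {α} {β} h = ⊆-antisym
    (⟪⟫-⇒ {α} {β} λ x → proj₁ (to (T-∧ {eval (world x) (α ⇒ᶠ β)}) (h x)))
    (⟪⟫-⇒ {β} {α} λ x → proj₂ (to (T-∧ {eval (world x) (α ⇒ᶠ β)}) (h x)))

  ⊤-holds : Holds ⊤ᶠ
  ⊤-holds x = from (⊨-⇒ {world x} ⊥ᶠ ⊥ᶠ) id

  ∨-¬-⟪⟫ : α ∈ˡ S → x ∈ˢ ⟪ α ⟫ ⊎ x ∈ˢ ⟪ ¬ᶠ α ⟫
  ∨-¬-⟪⟫ {α} {x} α∈S with closed α∈S α∈S
  ... | r ∷ _ = Sum.map (∈-⟪⟫⁺ α) (∈-⟪⟫⁺ (¬ᶠ α)) (to (T-∨ {eval (world x) α}) (r ⊤-holds x))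

  ∧-¬-○-⟪⟫ : α ∈ˡ S → x ∈ˢ ⟪ α ⟫ → x ∈ˢ ⟪ ¬ᶠ α ⟫ → x ∉ˢ ⟪ ○ᶠ α ⟫
  ∧-¬-○-⟪⟫ {α} {x} α∈S p q s with closed α∈S α∈S
  ... | _ ∷ r ∷ _ = ⊥-false x (to (⊨-⇒ ((α ∧ᶠ ¬ᶠ α) ∧ᶠ ○ᶠ α) ⊥ᶠ) (r ⊤-holds x)
    (from (T-∧ {eval (world x) (α ∧ᶠ ¬ᶠ α)})
      (from (T-∧ {eval (world x) α}) (∈-⟪⟫⁻ α p , ∈-⟪⟫⁻ (¬ᶠ α) q) , ∈-⟪⟫⁻ (○ᶠ α) s)))

  ∨-○-⟪⟫ : α ∈ˡ S → x ∈ˢ ⟪ α ⟫ ⊎ x ∈ˢ ⟪ ○ᶠ α ⟫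
  ∨-○-⟪⟫ {α} {x} α∈S with closed α∈S α∈S
  ... | _ ∷ _ ∷ r ∷ _ = Sum.map (∈-⟪⟫⁺ α) (∈-⟪⟫⁺ (○ᶠ α)) (to (T-∨ {eval (world x) α}) (r ⊤-holds x))

  ¬-cong-⟪⟫ : α ∈ˡ S → β ∈ˡ S → ⟪ α ⟫ ≡ ⟪ β ⟫ → ⟪ ¬ᶠ α ⟫ ≡ ⟪ ¬ᶠ β ⟫
  ¬-cong-⟪⟫ {α} {β} α∈S β∈S eq with closed α∈S β∈S
  ... | _ ∷ _ ∷ _ ∷ r ∷ _ = Holds⇒≡ {¬ᶠ α} {¬ᶠ β} (r (≡⇒Holds {α} {β} eq))

  ○-cong-⟪⟫ : α ∈ˡ S → β ∈ˡ S → ⟪ α ⟫ ≡ ⟪ β ⟫ → ⟪ ○ᶠ α ⟫ ≡ ⟪ ○ᶠ β ⟫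
  ○-cong-⟪⟫ {α} {β} α∈S β∈S eq with closed α∈S β∈S
  ... | _ ∷ _ ∷ _ ∷ _ ∷ r ∷ _ = Holds⇒≡ {○ᶠ α} {○ᶠ β} (r (≡⇒Holds {α} {β} eq))

  ¬○-⟪⟫ : α ∈ˡ S → β ∈ˡ S → ⟪ β ⟫ ≡ ⟪ ○ᶠ α ⟫ → ⟪ ¬ᶠ β ⟫ ⊆ ⟪ α ⟫
  ¬○-⟪⟫ {α} {β} α∈S β∈S eq with closed α∈S β∈S
  ... | _ ∷ _ ∷ _ ∷ _ ∷ _ ∷ r ∷ [] = ⟪⟫-⇒ {¬ᶠ β} {α} (r (≡⇒Holds {β} {○ᶠ α} eq))

  -- Twins satisfy the same formulas, but of `x` and `twin x` only the latter is in this set.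
  ∁⁅⁆-not-truth-set : ∀ β → ⟪ β ⟫ ≢ ∁ ⁅ x ⁆
  ∁⁅⁆-not-truth-set {x} β eq = x∈p⇒x∉∁p (x∈⁅x⁆ x) (subst (x ∈ˢ_) eq x∈β)
    where
    twin∈β : twin x ∈ˢ ⟪ β ⟫
    twin∈β = subst (twin x ∈ˢ_) (sym eq) (x∉p⇒x∈∁p (twin-≢ x ∘ x∈⁅y⁆⇒x≡y x))

    x∈β : x ∈ˢ ⟪ β ⟫
    x∈β = ∈-⟪⟫⁺ β (subst (_⊨ β) (twin-world x) (∈-⟪⟫⁻ β twin∈β))

  ⊥-empty : x ∉ˢ ⟪ ⊥ᶠ ⟫
  ⊥-empty = ⊥-false _ ∘ ∈-⟪⟫⁻ ⊥ᶠ

  -- As ⊥ᶠ ∈ S, the empty set is a truth set, so that any other kind of set has a point.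
  data Interpretation (a : Subset n) : Set where
    truth-set : α ∈ˡ S → ⟪ α ⟫ ≡ a → Interpretation a
    other     : (∀ {α} → α ∈ˡ S → ⟪ α ⟫ ≢ a) → x ∈ˢ a → Interpretation a

  interpret : ∀ a → Interpretation a
  interpret a with any? (λ α → Vec-≡-dec Bool._≟_ ⟪ α ⟫ a) S
  ... | yes p = let _ , α∈S , eq = find p in truth-set α∈S eq
  ... | no ¬p with nonempty? a
  ...   | yes (_ , x∈a) = other (λ α∈S eq → ¬p (lose α∈S eq)) x∈a
  ...   | no ¬x = contradiction
    (lose ⊥∈S (⊆-antisym (⊥-elim ∘ ⊥-empty) (λ x∈a → contradiction (_ , x∈a) ¬x))) ¬p

  -- The result depends on the stored formula or point; `interpret` fixes one choice for each set.
  neg con : Interpretation a → Subset n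
  neg     (truth-set {α} _ _) = ⟪ ¬ᶠ α ⟫
  neg {a} (other _ _)         = ∁ a
  con     (truth-set {α} _ _) = ⟪ ○ᶠ α ⟫
  con     (other {x} _ _)     = ∁ ⁅ x ⁆

  ∨-neg : (I : Interpretation a) → x ∈ˢ a ⊎ x ∈ˢ neg I
  ∨-neg             (truth-set α∈S refl) = ∨-¬-⟪⟫ α∈S
  ∨-neg {a} {x = x} (other _ _) with x ∈? a
  ... | yes p = inj₁ p
  ... | no ¬p = inj₂ (x∉p⇒x∈∁p ¬p)

  ∧-neg-con : (I : Interpretation a) → x ∈ˢ a → x ∈ˢ neg I → x ∉ˢ con I
  ∧-neg-con (truth-set α∈S refl) p q = ∧-¬-○-⟪⟫ α∈S p q
  ∧-neg-con (other _ _)          p q = contradiction q (x∈p⇒x∉∁p p)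

  -- If both are truth sets, `¬○-elim` applies; if only `a` is one, `∨-○` does. If only `con I` is
  -- one, twins give a contradiction. Otherwise `neg J` is the double complement of a singleton
  -- `⁅ x ⁆` with `x` in `a`.
  neg-con : (I : Interpretation a) (J : Interpretation (con I)) → neg J ⊆ a
  neg-con (truth-set α∈S refl) (truth-set β∈S eq) = ¬○-⟪⟫ α∈S β∈S eq
  neg-con (truth-set α∈S refl) (other _ _) p =
    [ id , (λ q → contradiction q (x∈∁p⇒x∉p p)) ]′ (∨-○-⟪⟫ α∈S)
  neg-con (other _ _)   (truth-set {β} _ eq) = ⊥-elim (∁⁅⁆-not-truth-set β eq)
  neg-con {a} (other _ x∈a) (other _ _) p =
    subst (_∈ˢ a) (sym (x∈⁅y⁆⇒x≡y _ (x∉∁p⇒x∈p (x∈∁p⇒x∉p p)))) x∈a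

  -- The interpretation may store another formula with the same truth set; closure under `R¬`
  -- reconciles the two.
  neg-truth-set : α ∈ˡ S → (I : Interpretation ⟪ α ⟫) → neg I ≡ ⟪ ¬ᶠ α ⟫
  neg-truth-set α∈S (truth-set β∈S eq) = ¬-cong-⟪⟫ β∈S α∈S eq
  neg-truth-set α∈S (other ≢a _)       = contradiction refl (≢a α∈S)

  con-truth-set : α ∈ˡ S → (I : Interpretation ⟪ α ⟫) → con I ≡ ⟪ ○ᶠ α ⟫
  con-truth-set α∈S (truth-set β∈S eq) = ○-cong-⟪⟫ β∈S α∈S eq
  con-truth-set α∈S (other ≢a _)       = contradiction refl (≢a α∈S)

  ¬ˢ_ ○ˢ_ : Subset n → Subset n
  ¬ˢ a = neg (interpret a)
  ○ˢ a = con (interpret a)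

  -- The complement must be literally `a ⇒ ⊥`, so the laws are transported along `∪-identityʳ`.
  isBooleanAlgebra : IsBooleanAlgebra _≡_ _∪_ _∩_ (λ a → ∁ a ∪ ⊥) ⊤ ⊥
  isBooleanAlgebra = record
    { isDistributiveLattice = BA.isDistributiveLattice
    ; ∨-complement = (λ a → trans (cong (_∪ a) (∪-identityʳ (∁ a))) (BA.∨-complementˡ a))
                   , (λ a → trans (cong (a ∪_) (∪-identityʳ (∁ a))) (BA.∨-complementʳ a))
    ; ∧-complement = (λ a → trans (cong (_∩ a) (∪-identityʳ (∁ a))) (BA.∧-complementˡ a))
                   , (λ a → trans (cong (a ∩_) (∪-identityʳ (∁ a))) (BA.∧-complementʳ a))
    ; ¬-cong = cong (λ a → ∁ a ∪ ⊥)
    }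
    where module BA = IsBooleanAlgebra (∪-∩-isBooleanAlgebra n)

  algebra : BALFI 0ℓ 0ℓ
  algebra = record
    { Carrier          = Subset n
    ; _≈_              = _≡_
    ; _∧_              = _∩_
    ; _∨_              = _∪_
    ; _⇒_              = λ a b → ∁ a ∪ b
    ; ¬_               = ¬ˢ_
    ; ○_               = ○ˢ_
    ; ⊥                = ⊥
    ; ⊤                = ⊤
    ; isBooleanAlgebra = isBooleanAlgebra
    ; ⇒-def            = λ a b → cong (_∪ b) (sym (∪-identityʳ (∁ a)))
    ; ¬-cong           = cong ¬ˢ_
    ; ○-cong           = cong ○ˢ_
    ; ∨-¬              = λ a → ⊆-antisym ⊆⊤ (λ _ → x∈p∪q⁺ (∨-neg (interpret a)))
    ; ∧-¬-○            = λ a → ⊆-antisym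
        (λ p → let q , o = x∈p∩q⁻ (a ∩ ¬ˢ a) (○ˢ a) p
                   t , f = x∈p∩q⁻ a (¬ˢ a) q
               in contradiction o (∧-neg-con (interpret a) t f))
        ⊥⊆
    }

  algebra-i1 : algebra ∈ BI[i1]
  algebra-i1 _ (i1 α) v = begin
    ⟦ ¬ᶠ ○ᶠ α ⇒ᶠ α ⟧          ≡⟨ ⇒-homo (¬ᶠ ○ᶠ α) α ⟩
    ∁ ⟦ ¬ᶠ ○ᶠ α ⟧ ∪ ⟦ α ⟧     ≡⟨ cong (λ a → ∁ a ∪ ⟦ α ⟧) (trans (¬-homo (○ᶠ α)) (cong ¬ˢ_ (○-homo α))) ⟩
    ∁ (¬ˢ (○ˢ ⟦ α ⟧)) ∪ ⟦ α ⟧ ≡⟨ ⊆-antisym ⊆⊤ (λ {x} _ → x∈p∪q⁺ (∁∪ x)) ⟩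
    ⊤                         ∎
    where
    open Valuation v
    open ≡-Reasoning

    ∁∪ : ∀ x → x ∈ˢ ∁ (¬ˢ (○ˢ ⟦ α ⟧)) ⊎ x ∈ˢ ⟦ α ⟧
    ∁∪ x with x ∈? ¬ˢ (○ˢ ⟦ α ⟧)
    ... | yes p = inj₂ (neg-con (interpret ⟦ α ⟧) (interpret (○ˢ ⟦ α ⟧)) p)
    ... | no ¬p = inj₁ (x∉p⇒x∈∁p ¬p)

  -- The homomorphic extension is used since `⟪_⟫` is known to commute with `¬` and `○` only on `S`.
  value : Formula → Subset n
  value (var i)  = ⟪ var i ⟫
  value (α ∧ᶠ β) = value α ∩ value β
  value (α ∨ᶠ β) = value α ∪ value β
  value (α ⇒ᶠ β) = ∁ (value α) ∪ value β
  value (¬ᶠ α)   = ¬ˢ value α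
  value (○ᶠ α)   = ○ˢ value α

  valuation : Valuation algebra
  valuation = record
    { ⟦_⟧    = value
    ; ∧-homo = λ _ _ → refl
    ; ∨-homo = λ _ _ → refl
    ; ⇒-homo = λ _ _ → refl
    ; ¬-homo = λ _ → refl
    ; ○-homo = λ _ → refl
    }

  -- Truth lemma. Membership in `S` is what makes the operations follow the formula at `¬ᶠ` and
  -- `○ᶠ`.
  value≡⟪⟫ : ∀ ψ → subformulas ψ ⊆ˡ S → value ψ ≡ ⟪ ψ ⟫
  value≡⟪⟫ (var i)  ⊆S = refl
  value≡⟪⟫ (α ∧ᶠ β) ⊆S = trans
    (cong₂ _∩_ (value≡⟪⟫ α (⊆S ∘ there ∘ ∈-++⁺ˡ)) (value≡⟪⟫ β (⊆S ∘ there ∘ ∈-++⁺ʳ (subformulas α))))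
    (zipWith-tabulate _ _ _)
  value≡⟪⟫ (α ∨ᶠ β) ⊆S = trans
    (cong₂ _∪_ (value≡⟪⟫ α (⊆S ∘ there ∘ ∈-++⁺ˡ)) (value≡⟪⟫ β (⊆S ∘ there ∘ ∈-++⁺ʳ (subformulas α))))
    (zipWith-tabulate _ _ _)
  value≡⟪⟫ (α ⇒ᶠ β) ⊆S = trans
    (cong₂ (λ a b → ∁ a ∪ b)
      (value≡⟪⟫ α (⊆S ∘ there ∘ ∈-++⁺ˡ)) (value≡⟪⟫ β (⊆S ∘ there ∘ ∈-++⁺ʳ (subformulas α))))
    (trans (cong (_∪ ⟪ β ⟫) (sym (tabulate-∘ not _))) (zipWith-tabulate _ _ _))
  value≡⟪⟫ (¬ᶠ α)   ⊆S = trans (cong ¬ˢ_ (value≡⟪⟫ α (⊆S ∘ there)))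
    (neg-truth-set (⊆S (there (∈-subformulas α))) (interpret ⟪ α ⟫))
  value≡⟪⟫ (○ᶠ α)   ⊆S = trans (cong ○ˢ_ (value≡⟪⟫ α (⊆S ∘ there)))
    (con-truth-set (⊆S (there (∈-subformulas α))) (interpret ⟪ α ⟫))

  satisfies⇒Holds : ∀ ψ → subformulas ψ ⊆ˡ S → valuation satisfies ψ → Holds ψ
  satisfies⇒Holds ψ ⊆S sat x =
    ∈-⟪⟫⁻ ψ (subst (x ∈ˢ_) (trans (sym sat) (value≡⟪⟫ ψ ⊆S)) ∈⊤)

-- Finiteness and the countermodel

Subset↔Fin : ∀ n → Fin (2 ^ n) ↔ Subset n
Subset↔Fin zero    = mk↔ₛ′ (λ _ → []) (λ _ → zero) (λ { [] → refl }) (λ { zero → refl })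
Subset↔Fin (suc n) = ↔-trans *↔× (↔-trans (2↔Bool ×-↔ Subset↔Fin n)
  (mk↔ₛ′ (uncurry _∷_) (λ { (b ∷ a) → b , a }) (λ { (_ ∷ _) → refl }) (λ _ → refl)))

opposite-≢ : ∀ (i : Fin 2) → opposite i ≢ i
opposite-≢ zero       ()
opposite-≢ (suc zero) ()

truth-set-model : ∀ φ W → let S = ⊥ᶠ ∷ subformulas φ in
  All (λ w → ¬ (w ⊨ ⊥ᶠ)) W →
  All (λ r → W ⊫ premise r → W ⊫ conclusion r) (concat (cartesianProductWith rules S S)) →
  Σ[ A ∈ BALFI 0ℓ 0ℓ ] (Finite A × A ∈ BI[i1] × Σ[ v ∈ Valuation A ] (v satisfies φ → W ⊫ φ))
truth-set-model φ W ⊥-false closed =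
  algebra , (2 ^ n , Subset↔Fin n) , algebra-i1 , valuation ,
  λ sat → holds⇒⊫ {φ} (satisfies⇒Holds φ there sat)
  where
  -- A point encodes a position in `W` and one of two copies; `twin` swaps the copies.
  n = length W * 2

  world : Fin n → World
  world x = lookup W (proj₁ (remQuot {length W} 2 x))

  twin : Fin n → Fin n
  twin x = let i , j = remQuot {length W} 2 x in combine i (opposite j)

  remQuot-twin : ∀ x → let i , j = remQuot {length W} 2 x in remQuot 2 (twin x) ≡ (i , opposite j)
  remQuot-twin x = remQuot-combine {length W} _ _

  holds⇒⊫ : ∀ {ψ} → (∀ x → world x ⊨ ψ) → W ⊫ ψ
  holds⇒⊫ {ψ} h = All.tabulate λ {w} w∈ → subst (_⊨ ψ)
    (trans (cong (lookup W ∘ proj₁) (remQuot-combine {length W} {2} (index w∈) zero))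
           (sym (lookup-index w∈)))
    -- Either copy would do.
    (h (combine (index w∈) zero))

  ⊫⇒holds : ∀ {ψ} → W ⊫ ψ → ∀ x → world x ⊨ ψ
  ⊫⇒holds p x = All.lookup p (∈-lookup _)

  open Truth-sets world
    (λ x → All.lookup ⊥-false (∈-lookup _))
    twin
    (λ x eq → opposite-≢ _ (cong proj₂ (trans (sym (remQuot-twin x)) (cong (remQuot {length W} 2) eq))))
    (λ x → cong (lookup W ∘ proj₁) (remQuot-twin x))
    (⊥ᶠ ∷ subformulas φ) (here refl)
    (λ α∈S β∈S → All.tabulate λ {r} r∈ p → ⊫⇒holds {conclusion r} (All.lookup closed
      (∈-concat⁺′ r∈ (∈-cartesianProductWith⁺ rules α∈S β∈S)) (holds⇒⊫ {premise r} p)))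

theorem5p7 : (φ : Formula) → ¬ (⊢RmbC[i1] φ) →
    Σ[ A ∈ BALFI 0ℓ 0ℓ ] (Finite A × A ∈ BI[i1] × Σ[ v ∈ Valuation A ] ¬ (v satisfies φ))
theorem5p7 φ ⊬φ =
  let S = ⊥ᶠ ∷ subformulas φ
      W , ⊥-false , closed , ⊫φ⇒⊢φ = saturation (concat (cartesianProductWith rules S S)) φ
      A , finite , A∈BI , v , sat⇒⊫ = truth-set-model φ W ⊥-false closed
  in A , finite , A∈BI , v , ⊬φ ∘ ⊫φ⇒⊢φ ∘ sat⇒⊫
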